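{- Let $\mathscr{A}=(G,\partial)$ and $\mathscr{A}'=(G,\partial')$ be unicyclizations of a connected graph $G$ such that $\operatorname{im}\partial=\operatorname{im}\partial'$. Let $\beta$ and $\beta'$ be bases of $Z_1(G)$. Then the winding number maps $w_{\mathscr{A}}(\cdot)=\det([\cdot]_\beta,[\partial]_\beta)$ relative to $\beta$ and $w_{\mathscr{A}'}(\cdot)=\det([\cdot]_{\beta'},[\partial']_{\beta'})$ relative to $\beta'$, as functions $Z_1(G)\to\mathbb{Z}$, are the same up to sign. Moreover $H_1(\mathscr{A})=H_1(\mathscr{A}')$.
   Context: Graphs are finite and connected; loops and multiple edges are allowed. Fix an orientation of each edge. $\partial_1:\mathbb{Z}^{E(G)}\to\mathbb{Z}^{V(G)}$ is the (oriented) incidence matrix (a loop gives a zero column). $Z_1(G)=\ker\partial_1$ is a free abelian group of rank $m=|E(G)|-|V(G)|+1$; bases are (ordered) $\mathbb{Z}$-bases. A unicyclizer of $G$ is an integer matrix $\partial$ (rows indexed by $E(G)$) with (1) $\ker\partial=0$, (2) $\partial_1\partial=0$, (3) $\operatorname{rk}(\ker\partial_1/\operatorname{im}\partial)=1$. So $\partial$ has $m-1$ linearly independent columns, all in $Z_1(G)$. The pair $\mathscr{A}=(G,\partial)$ is called a unicyclization of $G$, and $H_1(\mathscr{A})=\ker\partial_1/\operatorname{im}\partial$, where $\operatorname{im}\partial$ is the integral image. For a basis $\beta$ of $Z_1(G)$, $[z]_\beta\in\mathbb{Z}^m$ is the coordinate column vector of $z\in Z_1(G)$, $[\partial]_\beta$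 is the $m\times(m-1)$ matrix whose columns are the coordinate vectors of the columns of $\partial$, and $([z]_\beta,[\partial]_\beta)$ is the $m\times m$ matrix with first column $[z]_\beta$. -}

module Defs where

open import Algebra.Bundles using (AbelianGroup)
open import Algebra.Bundles.Raw using (RawGroup)
open import Algebra.Morphism.GroupMonomorphism using (isAbelianGroup)
open import Algebra.Morphism.Structures using (module GroupMorphisms)
import Algebra.Construct.Pointwise as Pointwise
import Algebra.Definitions.RawMonoid as RawMonoidOps
import Algebra.Properties.Semiring.Sum as SemiringSum
open import Data.Bool.Base using (if_then_else_)
open import Data.Fin.Base using (Fin; zero; suc; toℕ; punchIn)
open import Data.Fin.Properties using (_≟_)
open import Data.Integer.Base using (ℤ; +_; -[1+_]; 0ℤ; 1ℤ; -1ℤ; _+_; _-_; -_; _*_; _^_)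
open import Data.Integer.Properties using (+-*-semiring; +-0-abelianGroup; +-inverseʳ; *-zeroʳ; *-distribˡ-+; neg-distribʳ-*; neg-distrib-+)
open import Data.Integer.Tactic.RingSolver using (solve-∀)
open import Data.Nat.Base using (ℕ; zero; suc)
open import Data.Product.Base using (∃-syntax; _×_; _,_; proj₁; proj₂)
open import Data.Vec.Functional using (Vector; _∷_)
open import Level using (Level; 0ℓ; _⊔_)
open import Relation.Binary.Construct.Closure.Equivalence using (EqClosure)
open import Relation.Binary.PropositionalEquality using (_≡_; _≗_; refl; sym; trans; cong; cong₂; module ≡-Reasoning)
open import Relation.Nullary.Decidable.Core using (does)
open import Relation.Nullary.Negation.Core using (¬_)
open import Relation.Unary using (Pred; _∈_)

open GroupMorphisms using (IsGroupMonomorphism)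
open SemiringSum +-*-semiring using (sum; sum-syntax; sum-cong-≗; ∑-distrib-+; sum-replicate-zero)

private
  variable
    a ℓ : Level
    m n p : ℕ

------------------------------------------------------------------------
-- Integer matrices

Matrix : ℕ → ℕ → Set
Matrix m n = Fin m → Fin n → ℤ

infixr 7 _*ᵥ_ _*ₘ_

_*ᵥ_ : Matrix m n → Vector ℤ n → Vector ℤ m
_*ᵥ_ {n = n} A x i = ∑[ j < n ] (A i j * x j)

_*ₘ_ : Matrix m n → Matrix n p → Matrix m p
_*ₘ_ {n = n} A B i k = ∑[ j < n ] (A i j * B j k)

𝟎 : Vector ℤ n
𝟎 _ = 0ℤ

Kernel : Matrix m n → Pred (Vector ℤ n) 0ℓ
Kernel A x = A *ᵥ x ≗ 𝟎

-- The integral image, not its saturation.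
Image : Matrix m n → Pred (Vector ℤ m) 0ℓ
Image A y = ∃[ x ] A *ᵥ x ≗ y

minor : Fin (suc n) → Matrix (suc n) (suc n) → Matrix n n
minor i A i′ j′ = A (punchIn i i′) (suc j′)

-- Laplace expansion along the first column.
det : Matrix n n → ℤ
det {zero}  A = 1ℤ
det {suc n} A = ∑[ i < suc n ] (-1ℤ ^ toℕ i * A i zero * det (minor i A))

*ᵥ-+ : (A : Matrix m n) (x y : Vector ℤ n) →
       A *ᵥ (λ j → x j + y j) ≗ (λ i → (A *ᵥ x) i + (A *ᵥ y) i)
*ᵥ-+ A x y i = trans
  (sum-cong-≗ (λ j → *-distribˡ-+ (A i j) (x j) (y j)))
  (∑-distrib-+ (λ j → A i j * x j) (λ j → A i j * y j))

*ᵥ-𝟎 : (A : Matrix m n) → A *ᵥ 𝟎 ≗ 𝟎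
*ᵥ-𝟎 {n = n} A i = trans (sum-cong-≗ (λ j → *-zeroʳ (A i j))) (sum-replicate-zero n)

sum-neg : (x : Vector ℤ n) → ∑[ j < n ] (- x j) ≡ - sum x
sum-neg {zero}  x = refl
sum-neg {suc n} x = trans
  (cong (_+_ (- x zero)) (sum-neg (λ j → x (suc j))))
  (sym (neg-distrib-+ (x zero) (sum (λ j → x (suc j)))))

*ᵥ-neg : (A : Matrix m n) (x : Vector ℤ n) →
         A *ᵥ (λ j → - x j) ≗ (λ i → - (A *ᵥ x) i)
*ᵥ-neg A x i = trans
  (sum-cong-≗ (λ j → sym (neg-distribʳ-* (A i j) (x j))))
  (sum-neg (λ j → A i j * x j))

ℤ^ : ℕ → AbelianGroup 0ℓ 0ℓ
ℤ^ n = Pointwise.abelianGroup (Fin n) +-0-abelianGroup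

------------------------------------------------------------------------
-- Abelian groups as ℤ-modules: bases and rank

module _ (A : AbelianGroup a ℓ) where
  open AbelianGroup A
  open RawMonoidOps rawMonoid using () renaming (_×_ to _×ℕ_; sum to ∑)

  infixr 8 _·_

  _·_ : ℤ → Carrier → Carrier
  (+ n)    · x = n ×ℕ x
  -[1+ n ] · x = (suc n ×ℕ x) ⁻¹

  combination : Vector ℤ n → Vector Carrier n → Carrier
  combination c xs = ∑ (λ i → c i · xs i)

  Independent : Vector Carrier n → Set ℓ
  Independent xs = ∀ c → combination c xs ≈ ε → c ≗ 𝟎

  -- The rank is the largest size of a ℤ-independent family, so torsion
  -- is ignored.
  HasRank : ℕ → Set (a ⊔ ℓ)
  HasRank r = (∃[ xs ] Independent {r} xs) ×
              ((xs : Vector Carrier (suc r)) → ¬ Independent xs)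

  -- Ordered ℤ-bases.
  record Basis (r : ℕ) : Set (a ⊔ ℓ) where
    field
      vectors     : Vector Carrier r
      independent : Independent vectors
      spanning    : ∀ z → ∃[ c ] combination c vectors ≈ z

    coordinates : Carrier → Vector ℤ r
    coordinates z = proj₁ (spanning z)

------------------------------------------------------------------------
-- Graphs

-- Finite oriented multigraphs; loops and parallel edges are allowed.
record Graph : Set where
  field
    #V #E         : ℕ
    source target : Fin #E → Fin #V

  Adjacent : Fin #V → Fin #V → Set
  Adjacent u v = ∃[ e ] source e ≡ u × target e ≡ v

  -- Walks may traverse edges against the orientation.  The empty graph is
  -- not connected.
  Connected : Set
  Connected = Fin #V × (∀ u v → EqClosure Adjacent u v)

  ∂₁ : Matrix #V #E
  ∂₁ v e = δ (target e) - δ (source e)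
    where
    δ : Fin #V → ℤ
    δ u = if does (u ≟ v) then 1ℤ else 0ℤ

open Graph public using (Connected)

module _ (G : Graph) where
  open Graph G using (#E; ∂₁)
  open AbelianGroup (ℤ^ #E) using () renaming
    (_≈_ to _≈ᴱ_; _∙_ to _+ᴱ_; ε to 0ᴱ; _⁻¹ to -ᴱ_; isAbelianGroup to ℤᴱ-isAbelianGroup)

  Cycle : Set
  Cycle = ∃[ z ] z ∈ Kernel ∂₁

  private
    _⊕_ : Cycle → Cycle → Cycle
    (x , p) ⊕ (y , q) = x +ᴱ y , λ v → trans (*ᵥ-+ ∂₁ x y v) (cong₂ _+_ (p v) (q v))

    𝟘 : Cycle
    𝟘 = 0ᴱ , *ᵥ-𝟎 ∂₁

    ⊖_ : Cycle → Cycle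
    ⊖ (x , p) = -ᴱ x , λ v → trans (*ᵥ-neg ∂₁ x v) (cong -_ (p v))

    rawZ₁ : RawGroup 0ℓ 0ℓ
    rawZ₁ = record
      { Carrier = Cycle
      ; _≈_     = λ z z′ → proj₁ z ≈ᴱ proj₁ z′
      ; _∙_     = _⊕_
      ; ε       = 𝟘
      ; _⁻¹     = ⊖_
      }

  Z₁ : AbelianGroup 0ℓ 0ℓ
  Z₁ = record
    { RawGroup rawZ₁
    ; isAbelianGroup = isAbelianGroup inclusion ℤᴱ-isAbelianGroup
    }
    where
    refl′ : ∀ {z : Vector ℤ #E} → z ≈ᴱ z
    refl′ _ = refl

    inclusion : IsGroupMonomorphism rawZ₁ (AbelianGroup.rawGroup (ℤ^ #E)) proj₁
    inclusion = record
      { isGroupHomomorphism = record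
        { isMonoidHomomorphism = record
          { isMagmaHomomorphism = record
            { isRelHomomorphism = record { cong = λ p → p }
            ; homo = λ x y → refl′ {proj₁ (x ⊕ y)}
            }
          ; ε-homo = refl′ {0ᴱ}
          }
        ; ⁻¹-homo = λ x → refl′ {proj₁ (⊖ x)}
        }
      ; injective = λ p → p
      }

  -- ker ∂₁ / im ∂: cycles, identified when they differ by an element of
  -- im ∂.  This is meaningful for any ∂, but is the usual quotient only
  -- when ∂₁ ∂ = 0.
  H₁ : ∀ {k} → Matrix #E k → AbelianGroup 0ℓ 0ℓ
  H₁ {k} ∂ = record
    { Carrier = Cycle
    ; _≈_     = _∼_
    ; _∙_     = _⊕_
    ; ε       = 𝟘
    ; _⁻¹     = ⊖_
    ; isAbelianGroup = record
      { isGroup = record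
        { isMonoid = record
          { isSemigroup = record
            { isMagma = record
              { isEquivalence = record
                { refl  = λ {x} → ≈⇒∼ x x (λ _ → refl)
                ; sym   = λ {x} {y} → ∼-sym x y
                ; trans = λ {x} {y} {z} → ∼-trans x y z
                }
              ; ∙-cong = λ {x} {y} {u} {v} → ∼-cong x y u v
              }
            ; assoc = λ x y z → ≈⇒∼ ((x ⊕ y) ⊕ z) (x ⊕ (y ⊕ z)) (Z.assoc x y z)
            }
          ; identity = (λ x → ≈⇒∼ (𝟘 ⊕ x) x (Z.identityˡ x))
                     , (λ x → ≈⇒∼ (x ⊕ 𝟘) x (Z.identityʳ x))
          }
        ; inverse = (λ x → ≈⇒∼ ((⊖ x) ⊕ x) 𝟘 (Z.inverseˡ x))
                  , (λ x → ≈⇒∼ (x ⊕ (⊖ x)) 𝟘 (Z.inverseʳ x))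
        ; ⁻¹-cong = λ {x} {y} → ∼-neg x y
        }
      ; comm = λ x y → ≈⇒∼ (x ⊕ y) (y ⊕ x) (Z.comm x y)
      }
    }
    where
    module Z = AbelianGroup Z₁

    _∼_ : Cycle → Cycle → Set
    z ∼ z′ = proj₁ (z ⊕ (⊖ z′)) ∈ Image ∂

    ≈⇒∼ : ∀ x y → x Z.≈ y → x ∼ y
    ≈⇒∼ (x , _) (y , _) p = 𝟎 , λ e →
      trans (*ᵥ-𝟎 ∂ e) (sym (trans (cong (_+ - y e) (p e)) (+-inverseʳ (y e))))

    ∼-sym : ∀ x y → x ∼ y → y ∼ x
    ∼-sym (x , _) (y , _) (c , p) = (λ j → - c j) , λ e →
      trans (*ᵥ-neg ∂ c e) (trans (cong -_ (p e)) (lemma (x e) (y e)))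
      where
      lemma : ∀ s t → - (s + - t) ≡ t + - s
      lemma = solve-∀

    ∼-trans : ∀ x y z → x ∼ y → y ∼ z → x ∼ z
    ∼-trans (x , _) (y , _) (z , _) (c , p) (d , q) = (λ j → c j + d j) , λ e →
      trans (*ᵥ-+ ∂ c d e) (trans (cong₂ _+_ (p e) (q e)) (lemma (x e) (y e) (z e)))
      where
      lemma : ∀ s t u → (s + - t) + (t + - u) ≡ s + - u
      lemma = solve-∀

    ∼-cong : ∀ x y u v → x ∼ y → u ∼ v → (x ⊕ u) ∼ (y ⊕ v)
    ∼-cong (x , _) (y , _) (u , _) (v , _) (c , p) (d , q) = (λ j → c j + d j) , λ e →
      trans (*ᵥ-+ ∂ c d e)
        (trans (cong₂ _+_ (p e) (q e)) (lemma (x e) (y e) (u e) (v e)))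
      where
      lemma : ∀ s t u v → (s + - t) + (u + - v) ≡ (s + u) + - (t + v)
      lemma = solve-∀

    ∼-neg : ∀ x y → x ∼ y → (⊖ x) ∼ (⊖ y)
    ∼-neg (x , _) (y , _) (c , p) = (λ j → - c j) , λ e →
      trans (*ᵥ-neg ∂ c e) (trans (cong -_ (p e)) (lemma (x e) (y e)))
      where
      lemma : ∀ s t → - (s + - t) ≡ (- s) + - (- t)
      lemma = solve-∀

------------------------------------------------------------------------
-- Unicyclizations and winding numbers

record Unicyclizer (G : Graph) (k : ℕ) : Set where
  open Graph G using (#E; ∂₁)
  field
    ∂             : Matrix #E k
    trivialKernel : ∀ x → x ∈ Kernel ∂ → x ≗ 𝟎
    ∂₁∂≡0         : ∀ v j → (∂₁ *ₘ ∂) v j ≡ 0ℤ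
    rankOne       : HasRank (H₁ G ∂) 1

  column : Fin k → Cycle G
  column j = (λ e → ∂ e j) , λ v → ∂₁∂≡0 v j

open Unicyclizer public using (∂)

module _ {G : Graph} {k : ℕ} (𝒜 : Unicyclizer G k) where
  open Unicyclizer 𝒜 using (column)

  -- The k columns of ∂ are independent in Z₁ G and the quotient has rank
  -- one, so every basis of Z₁ G has exactly suc k elements; indexing β by
  -- Fin (suc k) excludes no basis and makes the matrix square.
  windingMatrix : Basis (Z₁ G) (suc k) → Cycle G → Matrix (suc k) (suc k)
  windingMatrix β z i = coordinates z i ∷ (λ j → coordinates (column j) i)
    where open Basis β using (coordinates)

  winding : Basis (Z₁ G) (suc k) → Cycle G → ℤ
  winding β z = det (windingMatrix β z)

{-# OPTIONS --safe #-}
module Submission where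

-- Let V and V′ hold the edge vectors of the bases β and β′ in their columns.  Since V and V′ are
-- injective with the same image, V′ = V P with P invertible over ℤ; likewise ∂ = ∂′ M with M
-- invertible, and in particular ∂ and ∂′ have equally many columns.  Hence
--   V ([z]_β , [∂]_β) = (z , ∂) = (z , ∂′) (1 ⊕ M) = V P ([z]_β′ , [∂′]_β′) (1 ⊕ M),
-- and cancelling V gives w = det P · det M · w′, where det P and det M are units of ℤ.
--
-- Multiplicativity of det comes from the uniqueness of alternating forms in the rows of a square
-- matrix.  Such a form is det (A ᵀ) times its value at the identity, because det (A ᵀ) is expanded
-- along the first row of A; as det itself is alternating in the rows, det A = det (A ᵀ).

open import Defs
open import Algebra.Bundles using (AbelianGroup)
import Algebra.Definitions.RawMonoid as RawMonoidOps
open import Algebra.Morphism.Structures using (module GroupMorphisms)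
import Algebra.Properties.Semiring.Sum as SemiringSum
open import Data.Empty using (⊥)
open import Data.Fin.Base using (Fin; zero; suc; toℕ; punchIn)
open import Data.Integer.Base using (ℤ; 0ℤ; 1ℤ; -1ℤ; _+_; -_; _*_; _^_; -[1+_]; ∣_∣)
open import Data.Integer.Properties using (+-*-semiring; +-identityˡ; +-identityʳ; +-inverseʳ; *-assoc; *-comm; *-zeroˡ; *-zeroʳ; *-identityˡ; *-identityʳ; *-distribʳ-+; neg-distribˡ-*; -1*i≡-i; abs-*)
open import Data.Integer.Tactic.RingSolver using (solve-∀)
open import Data.Nat.Base using (ℕ; zero; suc)
import Data.Nat.Base as ℕ
import Data.Nat.Properties as ℕ
open import Data.Product.Base using (_×_; ∃-syntax; _,_; proj₁; proj₂)
open import Data.Sum.Base using (_⊎_; inj₁; inj₂)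
open import Data.Unit.Base using (⊤; tt)
open import Data.Vec.Functional using (Vector; _∷_; map; head; tail; insertAt; removeAt)
open import Function.Base using (_∘_; flip; id)
open import Relation.Binary.PropositionalEquality using (_≡_; _≗_; refl; sym; trans; cong; cong₂; module ≡-Reasoning)
open import Relation.Unary using (_≐_; _⊆_)
open AbelianGroup using (rawGroup)
open GroupMorphisms using (IsGroupIsomorphism)
open SemiringSum +-*-semiring using (sum; sum-syntax; sum-cong-≗; ∑-distrib-+; ∑-comm; sum-replicate-zero; *-distribˡ-sum; *-distribʳ-sum)
open ≡-Reasoning

private
  variable
    m n p q : ℕ

-- Pointwise equality of matrices and finite sums

infix 4 _≋_

_≋_ : Matrix m n → Matrix m n → Set
A ≋ B = ∀ i → A i ≗ B i

∷-η : (A : Matrix (suc n) p) → A ≋ head A ∷ tail A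
∷-η A zero    _ = refl
∷-η A (suc _) _ = refl

∷-cong : {u v : Vector ℤ p} {A B : Matrix n p} → u ≗ v → A ≋ B → (u ∷ A) ≋ (v ∷ B)
∷-cong u≗v A≋B zero    = u≗v
∷-cong u≗v A≋B (suc i) = A≋B i

map-∷ : (f : Vector ℤ p → Vector ℤ q) (u : Vector ℤ p) (A : Matrix n p) →
        map f (u ∷ A) ≋ f u ∷ map f A
map-∷ f u A zero    _ = refl
map-∷ f u A (suc _) _ = refl

∑-combination : ∀ a b (x y : Vector ℤ n) →
                ∑[ i < n ] (a * x i + b * y i) ≡ a * sum x + b * sum y
∑-combination a b x y = trans (∑-distrib-+ (λ i → a * x i) (λ i → b * y i))
  (sym (cong₂ _+_ (*-distribˡ-sum a x) (*-distribˡ-sum b y)))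

∑-zero : {x : Vector ℤ n} → x ≗ 𝟎 → sum x ≡ 0ℤ
∑-zero {n = n} x≗𝟎 = trans (sum-cong-≗ x≗𝟎) (sum-replicate-zero n)

-- Alternating forms in the rows of a matrix

Congruent : (Matrix n p → ℤ) → Set
Congruent D = ∀ {A B} → A ≋ B → D A ≡ D B

HeadLinear : (Matrix (suc n) p → ℤ) → Set
HeadLinear D = ∀ a b u v A →
  D ((λ k → a * u k + b * v k) ∷ A) ≡ a * D (u ∷ A) + b * D (v ∷ A)

HeadAlternating : (Matrix (suc n) p → ℤ) → Set
HeadAlternating {n = zero}  D = ⊤
HeadAlternating {n = suc n} D = ∀ u A → D (u ∷ u ∷ A) ≡ 0ℤ

-- The conditions are stated only for the top rows and then for every form obtained by fixing the
-- top row. Thus linearity is required in each row and vanishing only for equal adjacent rows, and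
-- proofs go by induction on the number of rows. The number of columns is independent of it, since
-- fixing rows leaves rectangular matrices.
data Alternating {p} : ∀ {n} → (Matrix n p → ℤ) → Set where
  nullary : {D : Matrix 0 p → ℤ} → Congruent D → Alternating D
  curried : {D : Matrix (suc n) p → ℤ} →
            Congruent D → HeadLinear D → HeadAlternating D →
            (∀ u → Alternating (D ∘ (u ∷_))) → Alternating D

congruent : {D : Matrix n p → ℤ} → Alternating D → Congruent D
congruent (nullary c)       = c
congruent (curried c _ _ _) = c

headLinear : {D : Matrix (suc n) p → ℤ} → Alternating D → HeadLinear D
headLinear (curried _ l _ _) = l

restrict : {D : Matrix (suc n) p → ℤ} → Alternating D → ∀ u → Alternating (D ∘ (u ∷_))
restrict (curried _ _ _ r) = r

headAlternating-resp : {D E : Matrix (suc n) p → ℤ} → D ≗ E →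
                       HeadAlternating D → HeadAlternating E
headAlternating-resp {n = zero}  D≗E h = tt
headAlternating-resp {n = suc n} D≗E h u A = trans (sym (D≗E (u ∷ u ∷ A))) (h u A)

alternating-resp : {D E : Matrix n p → ℤ} → D ≗ E → Alternating D → Alternating E
alternating-resp D≗E (nullary c) =
  nullary λ {A} {B} A≋B → trans (sym (D≗E A)) (trans (c A≋B) (D≗E B))
alternating-resp D≗E (curried c l h r) = curried
  (λ {A} {B} A≋B → trans (sym (D≗E A)) (trans (c A≋B) (D≗E B)))
  (λ a b u v A → trans (sym (D≗E _)) (trans (l a b u v A)
     (cong₂ (λ x y → a * x + b * y) (D≗E _) (D≗E _))))
  (headAlternating-resp D≗E h)
  (λ u → alternating-resp (λ A → D≗E (u ∷ A)) (r u))

-- Needed because fixing the top row in a first-column expansion leaves a combination of two forms.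
alternating-combination : ∀ a b {D E : Matrix n p → ℤ} → Alternating D → Alternating E →
                          Alternating (λ A → a * D A + b * E A)
alternating-combination a b (nullary c) (nullary c′) =
  nullary λ A≋B → cong₂ (λ x y → a * x + b * y) (c A≋B) (c′ A≋B)
alternating-combination {n = suc n} a b {D} {E} (curried c l h r) (curried c′ l′ h′ r′) = curried
  (λ A≋B → cong₂ (λ x y → a * x + b * y) (c A≋B) (c′ A≋B))
  (λ s t u v A → trans
     (cong₂ (λ x y → a * x + b * y) (l s t u v A) (l′ s t u v A))
     (interchange a b s t (D (u ∷ A)) (D (v ∷ A)) (E (u ∷ A)) (E (v ∷ A))))
  (alt n h h′)
  (λ u → alternating-combination a b (r u) (r′ u))
  where
  interchange : ∀ a b s t x y x′ y′ →
                a * (s * x + t * y) + b * (s * x′ + t * y′) ≡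
                s * (a * x + b * x′) + t * (a * y + b * y′)
  interchange = solve-∀
  alt : ∀ n {D E : Matrix (suc n) p → ℤ} → HeadAlternating D → HeadAlternating E →
        HeadAlternating (λ A → a * D A + b * E A)
  alt zero    h h′ = tt
  alt (suc n) h h′ u A = trans (cong₂ (λ x y → a * x + b * y) (h u A) (h′ u A))
    (cong₂ _+_ (*-zeroʳ a) (*-zeroʳ b))

record Linear (f : Vector ℤ p → Vector ℤ q) : Set where
  field
    resp : ∀ {u v} → u ≗ v → f u ≗ f v
    homo : ∀ a b u v → f (λ k → a * u k + b * v k) ≗ λ k → a * f u k + b * f v k

-- A linear map applied to every row preserves linearity in each row and equality of rows. It is
-- applied to dropping the first entry, to inserting a zero entry, and to multiplication by a matrix
-- on the right.
alternating-map : {f : Vector ℤ p → Vector ℤ q} → Linear f → {D : Matrix n q → ℤ} →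
                  Alternating D → Alternating (D ∘ map f)
alternating-map f-lin (nullary c) = nullary λ _ → c λ ()
alternating-map {p = p} {q = q} {n = suc n} {f} f-lin {D} (curried c l h r) = curried
  (λ A≋B → c λ i → resp (A≋B i))
  (λ a b u v A → begin
    D (map f ((λ k → a * u k + b * v k) ∷ A))
      ≡⟨ c (map-∷ f _ A) ⟩
    D (f (λ k → a * u k + b * v k) ∷ map f A)
      ≡⟨ c (∷-cong (homo a b u v) λ _ _ → refl) ⟩
    D ((λ k → a * f u k + b * f v k) ∷ map f A)
      ≡⟨ l a b (f u) (f v) (map f A) ⟩
    a * D (f u ∷ map f A) + b * D (f v ∷ map f A)
      ≡⟨ cong₂ (λ x y → a * x + b * y) (c (map-∷ f u A)) (c (map-∷ f v A)) ⟨
    a * D (map f (u ∷ A)) + b * D (map f (v ∷ A)) ∎)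
  (alt n D c h)
  (λ u → alternating-resp (λ A → sym (c (map-∷ f u A))) (alternating-map f-lin (r (f u))))
  where
  open Linear f-lin
  alt : ∀ n (D : Matrix (suc n) q → ℤ) → Congruent D → HeadAlternating D →
        HeadAlternating (D ∘ map f)
  alt zero    D c h = tt
  alt (suc n) D c h u A = trans
    (c λ { zero _ → refl ; (suc zero) _ → refl ; (suc (suc _)) _ → refl })
    (h (f u) (map f A))

tail-linear : Linear {suc p} {p} tail
tail-linear = record
  { resp = λ u≗v k → u≗v (suc k)
  ; homo = λ _ _ _ _ _ → refl
  }

-- Expansion along the first column

-- The rectangular version of `minor`; accordingly, `expansion det` is the determinant of the next
-- size.
dropRow : Fin (suc n) → Matrix (suc n) (suc p) → Matrix n p
dropRow i A i′ j′ = A (punchIn i i′) (suc j′)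

expansion : (Matrix n p → ℤ) → Matrix (suc n) (suc p) → ℤ
expansion {n = n} F A =
  ∑[ i < suc n ] (-1ℤ ^ toℕ i * A i zero * F (dropRow i A))

expansion-cong : {F : Matrix n p → ℤ} → Congruent F → Congruent (expansion F)
expansion-cong c A≋B = sum-cong-≗ λ i →
  cong₂ (λ x y → -1ℤ ^ toℕ i * x * y) (A≋B i zero) (c λ i′ j′ → A≋B (punchIn i i′) (suc j′))

expansion-resp : {F G : Matrix n p → ℤ} → F ≗ G → expansion F ≗ expansion G
expansion-resp F≗G A = sum-cong-≗ λ i →
  cong (-1ℤ ^ toℕ i * A i zero *_) (F≗G (dropRow i A))

expansion-zero : {F : Matrix n p → ℤ} → (∀ A → F A ≡ 0ℤ) → ∀ A → expansion F A ≡ 0ℤ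
expansion-zero F≗0 A = ∑-zero λ i →
  trans (cong (-1ℤ ^ toℕ i * A i zero *_) (F≗0 (dropRow i A))) (*-zeroʳ (-1ℤ ^ toℕ i * A i zero))

expansion-combination : ∀ a b (F G : Matrix n p → ℤ) A →
  expansion (λ B → a * F B + b * G B) A ≡ a * expansion F A + b * expansion G A
expansion-combination a b F G A = trans
  (sum-cong-≗ λ i → distrib a b (-1ℤ ^ toℕ i * A i zero) (F (dropRow i A)) (G (dropRow i A)))
  (∑-combination a b
    (λ i → -1ℤ ^ toℕ i * A i zero * F (dropRow i A))
    (λ i → -1ℤ ^ toℕ i * A i zero * G (dropRow i A)))
  where
  distrib : ∀ a b s x y → s * (a * x + b * y) ≡ a * (s * x) + b * (s * y)
  distrib = solve-∀

dropRow-∷ : (i : Fin (suc n)) (u : Vector ℤ (suc p)) (A : Matrix (suc n) (suc p)) →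
            dropRow (suc i) (u ∷ A) ≋ tail u ∷ dropRow i A
dropRow-∷ i u A zero    _ = refl
dropRow-∷ i u A (suc _) _ = refl

-- Only the first term deletes the top row `u`. Every other cofactor keeps `tail u` on top, and its
-- row index is shifted by one, whence the factor `-1ℤ`.
expansion-∷ : {F : Matrix (suc n) p → ℤ} → Congruent F → ∀ u A →
  expansion F (u ∷ A) ≡ u zero * F (map tail A) + -1ℤ * expansion (F ∘ (tail u ∷_)) A
expansion-∷ {F = F} c u A = cong₂ _+_
  (cong (_* F (map tail A)) (*-identityˡ (u zero)))
  (trans
    (sum-cong-≗ λ i → trans
      (cong (-1ℤ * -1ℤ ^ toℕ i * A i zero *_) (c (dropRow-∷ i u A)))
      (assoc (-1ℤ ^ toℕ i) (A i zero) (F (tail u ∷ dropRow i A))))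
    (sym (*-distribˡ-sum -1ℤ (λ i → -1ℤ ^ toℕ i * A i zero * F (tail u ∷ dropRow i A)))))
  where
  assoc : ∀ s x y → -1ℤ * s * x * y ≡ -1ℤ * (s * x * y)
  assoc = solve-∀

expansion-alternating : {F : Matrix n p → ℤ} → Alternating F → Alternating (expansion F)
-- With a single row the expansion is its first entry times the constant value of `F`.
expansion-alternating {F = F} (nullary c) = curried
  (expansion-cong c)
  (λ a b u v A → trans
     (cong (λ x → 1ℤ * (a * u zero + b * v zero) * x + 0ℤ) (c λ ()))
     (trans (lemma a b (u zero) (v zero) (F (map tail A)))
       (cong₂ (λ x y → a * (1ℤ * u zero * x + 0ℤ) + b * (1ℤ * v zero * y + 0ℤ)) (c λ ()) (c λ ()))))
  tt
  (λ u → nullary λ {A} {B} _ → expansion-cong c (∷-cong {u = u} {A = A} {B = B} (λ _ → refl) λ ()))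
  where
  lemma : ∀ a b x y f → 1ℤ * (a * x + b * y) * f + 0ℤ ≡
                        a * (1ℤ * x * f + 0ℤ) + b * (1ℤ * y * f + 0ℤ)
  lemma = solve-∀
expansion-alternating {n = suc n} {F = F} F-alt@(curried c l h r) = curried
  (expansion-cong c)
  (λ a b u v A → begin
    expansion F ((λ k → a * u k + b * v k) ∷ A)
      ≡⟨ expansion-∷ c (λ k → a * u k + b * v k) A ⟩
    (a * u zero + b * v zero) * F (map tail A) +
      -1ℤ * expansion (F ∘ ((λ k → a * tail u k + b * tail v k) ∷_)) A
      ≡⟨ cong (λ x → (a * u zero + b * v zero) * F (map tail A) + -1ℤ * x)
           (trans (expansion-resp (l a b (tail u) (tail v)) A)
                  (expansion-combination a b (F ∘ (tail u ∷_)) (F ∘ (tail v ∷_)) A)) ⟩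
    (a * u zero + b * v zero) * F (map tail A) +
      -1ℤ * (a * expansion (F ∘ (tail u ∷_)) A + b * expansion (F ∘ (tail v ∷_)) A)
      ≡⟨ regroup a b (u zero) (v zero) (F (map tail A)) _ _ ⟩
    a * (u zero * F (map tail A) + -1ℤ * expansion (F ∘ (tail u ∷_)) A) +
      b * (v zero * F (map tail A) + -1ℤ * expansion (F ∘ (tail v ∷_)) A)
      ≡⟨ cong₂ (λ x y → a * x + b * y) (expansion-∷ c u A) (expansion-∷ c v A) ⟨
    a * expansion F (u ∷ A) + b * expansion F (v ∷ A) ∎)
  (alt n F-alt)
  -- By `expansion-∷`, fixing the top row leaves a combination of `F` on the tails and an expansion
  -- of a form with one row fewer, to which induction applies.
  (λ u → alternating-resp (λ A → sym (expansion-∷ c u A))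
     (alternating-combination (u zero) -1ℤ
       (alternating-map tail-linear F-alt) (expansion-alternating (r (tail u)))))
  where
  regroup : ∀ a b x y f s t → (a * x + b * y) * f + -1ℤ * (a * s + b * t) ≡
                              a * (x * f + -1ℤ * s) + b * (y * f + -1ℤ * t)
  regroup = solve-∀
  cancel : ∀ x → x + -1ℤ * (x + -1ℤ * 0ℤ) ≡ 0ℤ
  cancel = solve-∀
  -- The terms of two equal top rows cancel; in all others the cofactor has a repeated row.
  alt : ∀ n {F : Matrix (suc n) p → ℤ} → Alternating F → HeadAlternating (expansion F)
  alt zero {F} (curried c _ _ _) u A = trans (expansion-∷ c u (u ∷ A)) (trans
    (cong₂ (λ x y → u zero * x + -1ℤ * (1ℤ * u zero * y + 0ℤ))
      (c λ { zero _ → refl }) (c λ { zero _ → refl }))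
    (cancel₁ (u zero) (F (tail u ∷ map tail A))))
    where
    cancel₁ : ∀ x f → x * f + -1ℤ * (1ℤ * x * f + 0ℤ) ≡ 0ℤ
    cancel₁ = solve-∀
  alt (suc n) {F} (curried c l h r) u A = begin
    expansion F (u ∷ u ∷ A)
      ≡⟨ expansion-∷ c u (u ∷ A) ⟩
    u zero * F (map tail (u ∷ A)) + -1ℤ * expansion (F ∘ (tail u ∷_)) (u ∷ A)
      ≡⟨ cong₂ (λ x y → u zero * x + -1ℤ * y) (c (map-∷ tail u A))
           (trans (expansion-∷ (congruent (r (tail u))) u A)
             (cong (λ x → u zero * F (tail u ∷ map tail A) + -1ℤ * x)
               (expansion-zero (h (tail u)) A))) ⟩
    u zero * F (tail u ∷ map tail A) + -1ℤ * (u zero * F (tail u ∷ map tail A) + -1ℤ * 0ℤ)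
      ≡⟨ cancel (u zero * F (tail u ∷ map tail A)) ⟩
    0ℤ ∎

det-alternating : Alternating (det {n})
det-alternating {n = zero}  = nullary λ _ → refl
det-alternating {n = suc n} = expansion-alternating (det-alternating {n})

-- Alternating forms on square matrices are multiples of the determinant

_ᵀ : Matrix m n → Matrix n m
_ᵀ = flip

-- The standard basis vectors; read as a matrix, `unit` is the identity.
unit : Fin n → Vector ℤ n
unit zero    = 1ℤ ∷ 𝟎
unit (suc i) = 0ℤ ∷ unit i

∑-unit : (x : Vector ℤ n) (k : Fin n) → ∑[ j < n ] (x j * unit j k) ≡ x k
∑-unit x zero    = trans
  (cong₂ _+_ (*-identityʳ (x zero)) (∑-zero λ j → *-zeroʳ (x (suc j))))
  (+-identityʳ (x zero))
∑-unit x (suc k) = trans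
  (cong₂ _+_ (*-zeroʳ (x zero)) (∑-unit (tail x) k))
  (+-identityˡ (x (suc k)))

insert-𝟎 : ∀ (i : Fin (suc n)) → insertAt 𝟎 i 0ℤ ≗ 𝟎
insert-𝟎 zero zero = refl
insert-𝟎 zero (suc k) = refl
insert-𝟎 {n = suc n} (suc i) zero = refl
insert-𝟎 {n = suc n} (suc i) (suc k) = insert-𝟎 i k

-- Identifies the image of the smaller identity matrix with the larger one without row `j`.
insert-unit : (j : Fin (suc n)) (i : Fin n) → insertAt (unit i) j 0ℤ ≗ unit (punchIn j i)
insert-unit zero    i       zero    = refl
insert-unit zero    i       (suc k) = refl
insert-unit (suc j) zero    zero    = refl
insert-unit (suc j) zero    (suc k) = insert-𝟎 j k
insert-unit (suc j) (suc i) zero    = refl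
insert-unit (suc j) (suc i) (suc k) = insert-unit j i k

insert-linear : (j : Fin (suc n)) → Linear (λ x → insertAt x j 0ℤ)
insert-linear j = record { resp = resp j ; homo = homo j }
  where
  resp : (j : Fin (suc n)) {u v : Vector ℤ n} → u ≗ v → insertAt u j 0ℤ ≗ insertAt v j 0ℤ
  resp zero u≗v zero = refl
  resp zero u≗v (suc k) = u≗v k
  resp {n = suc n} (suc j) u≗v zero = u≗v zero
  resp {n = suc n} (suc j) u≗v (suc k) = resp j (u≗v ∘ suc) k
  homo : ∀ (j : Fin (suc n)) a b u v → insertAt (λ k → a * u k + b * v k) j 0ℤ ≗
         λ k → a * insertAt u j 0ℤ k + b * insertAt v j 0ℤ k
  homo zero a b u v zero = sym (cong₂ _+_ (*-zeroʳ a) (*-zeroʳ b))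
  homo zero a b u v (suc k) = refl
  homo {n = suc n} (suc j) a b u v zero = refl
  homo {n = suc n} (suc j) a b u v (suc k) = homo j a b (tail u) (tail v) k

-- Splits off the `j`-th entry. The factor `1ℤ` gives the left-hand side the shape that
-- `addMultiples` simplifies.
insert-remove : (j : Fin (suc n)) (x : Vector ℤ (suc n)) →
                (λ k → 1ℤ * insertAt (removeAt x j) j 0ℤ k + x j * unit j k) ≗ x
insert-remove zero x zero = trans (+-identityˡ _) (*-identityʳ (x zero))
insert-remove zero x (suc k) = trans
  (cong₂ _+_ (*-identityˡ (x (suc k))) (*-zeroʳ (x zero))) (+-identityʳ (x (suc k)))
insert-remove {n = suc n} (suc j) x zero = trans
  (cong₂ _+_ (*-identityˡ (x zero)) (*-zeroʳ (x (suc j)))) (+-identityʳ (x zero))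
insert-remove {n = suc n} (suc j) x (suc k) = insert-remove j (tail x) k

headLinear-∑ : {D : Matrix (suc n) p → ℤ} → Alternating D →
               (x : Vector ℤ m) (U : Matrix m p) (A : Matrix n p) →
               D ((λ k → ∑[ j < m ] (x j * U j k)) ∷ A) ≡ ∑[ j < m ] (x j * D (U j ∷ A))
headLinear-∑ {m = zero} D-alt x U A = trans
  -- The empty sum is the zero row, written as a combination with zero coefficients so that
  -- linearity yields the value zero.
  (congruent D-alt (∷-cong {v = λ k → 0ℤ * 𝟎 k + 0ℤ * 𝟎 k} {A = A} (λ _ → refl) λ _ _ → refl))
  (headLinear D-alt 0ℤ 0ℤ 𝟎 𝟎 A)
headLinear-∑ {m = suc m} {D = D} D-alt x U A = begin
  D ((λ k → x zero * U zero k + s k) ∷ A)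
    ≡⟨ congruent D-alt (∷-cong
         (λ k → cong (x zero * U zero k +_) (sym (*-identityˡ (s k)))) λ _ _ → refl) ⟩
  D ((λ k → x zero * U zero k + 1ℤ * s k) ∷ A)
    ≡⟨ headLinear D-alt (x zero) 1ℤ (U zero) s A ⟩
  x zero * D (U zero ∷ A) + 1ℤ * D (s ∷ A)
    ≡⟨ cong (x zero * D (U zero ∷ A) +_)
         (trans (*-identityˡ _) (headLinear-∑ D-alt (tail x) (tail U) A)) ⟩
  ∑[ j < suc m ] (x j * D (U j ∷ A)) ∎
  where
  s = λ k → ∑[ j < m ] (x (suc j) * U (suc j) k)

-- Polarisation: expand the vanishing value at two top rows both equal to `u + v`.
swap : {D : Matrix (suc (suc n)) p → ℤ} → Alternating D →
       ∀ u v A → D (u ∷ v ∷ A) ≡ -1ℤ * D (v ∷ u ∷ A)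
swap {D = D} (curried c l h r) u v A = begin
  D (u ∷ v ∷ A)
    ≡⟨ rearrange (D (u ∷ v ∷ A)) (D (v ∷ u ∷ A)) ⟩
  1ℤ * (1ℤ * 0ℤ + 1ℤ * D (u ∷ v ∷ A)) + 1ℤ * (1ℤ * D (v ∷ u ∷ A) + 1ℤ * 0ℤ) + -1ℤ * D (v ∷ u ∷ A)
    ≡⟨ cong (_+ -1ℤ * D (v ∷ u ∷ A)) expand ⟨
  0ℤ + -1ℤ * D (v ∷ u ∷ A)
    ≡⟨ +-identityˡ _ ⟩
  -1ℤ * D (v ∷ u ∷ A) ∎
  where
  w : Vector ℤ _
  w k = 1ℤ * u k + 1ℤ * v k
  rearrange : ∀ x y → x ≡ 1ℤ * (1ℤ * 0ℤ + 1ℤ * x) + 1ℤ * (1ℤ * y + 1ℤ * 0ℤ) + -1ℤ * y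
  rearrange = solve-∀
  expand : 0ℤ ≡ 1ℤ * (1ℤ * 0ℤ + 1ℤ * D (u ∷ v ∷ A)) + 1ℤ * (1ℤ * D (v ∷ u ∷ A) + 1ℤ * 0ℤ)
  expand = begin
    0ℤ
      ≡⟨ h w A ⟨
    D (w ∷ w ∷ A)
      ≡⟨ l 1ℤ 1ℤ u v (w ∷ A) ⟩
    1ℤ * D (u ∷ w ∷ A) + 1ℤ * D (v ∷ w ∷ A)
      ≡⟨ cong₂ (λ x y → 1ℤ * x + 1ℤ * y)
           (headLinear (r u) 1ℤ 1ℤ u v A) (headLinear (r v) 1ℤ 1ℤ u v A) ⟩
    1ℤ * (1ℤ * D (u ∷ u ∷ A) + 1ℤ * D (u ∷ v ∷ A)) + 1ℤ * (1ℤ * D (v ∷ u ∷ A) + 1ℤ * D (v ∷ v ∷ A))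
      ≡⟨ cong₂ (λ x y → 1ℤ * (1ℤ * x + 1ℤ * D (u ∷ v ∷ A)) + 1ℤ * (1ℤ * D (v ∷ u ∷ A) + 1ℤ * y))
           (h u A) (h v A) ⟩
    1ℤ * (1ℤ * 0ℤ + 1ℤ * D (u ∷ v ∷ A)) + 1ℤ * (1ℤ * D (v ∷ u ∷ A) + 1ℤ * 0ℤ) ∎

-- Swaps carry `u` down until it is adjacent to its copy; each changes only the sign.
headRepeated : {D : Matrix (suc n) p → ℤ} → Alternating D →
               ∀ u A i → A i ≗ u → D (u ∷ A) ≡ 0ℤ
headRepeated {D = D} (curried c l h r) u A zero A₀≗u = trans
  (c λ { zero _ → refl ; (suc zero) → A₀≗u ; (suc (suc i)) _ → refl })
  (h u (tail A))
headRepeated {n = suc n} {D = D} D-alt@(curried c l h r) u A (suc i) Aᵢ≗u = begin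
  D (u ∷ A)
    ≡⟨ c (∷-cong {u = u} (λ _ → refl) (∷-η A)) ⟩
  D (u ∷ head A ∷ tail A)
    ≡⟨ swap D-alt u (head A) (tail A) ⟩
  -1ℤ * D (head A ∷ u ∷ tail A)
    ≡⟨ cong (-1ℤ *_) (headRepeated (r (head A)) u (tail A) i Aᵢ≗u) ⟩
  0ℤ ∎

-- Expanding row by row, each extra term has `u` as a row and vanishes. Vanishing on matrices with
-- row `u` is a hypothesis that survives fixing the top row, so the induction goes through.
addMultiples : {D : Matrix n p → ℤ} → Alternating D → ∀ u →
               (∀ A i → A i ≗ u → D A ≡ 0ℤ) →
               ∀ (c : Vector ℤ n) A → D (λ i k → 1ℤ * A i k + c i * u k) ≡ D A
addMultiples (nullary cg) u van c A = cg λ ()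
addMultiples {n = suc n} {D = D} D-alt u van c A = begin
  D A′
    ≡⟨ congruent D-alt (∷-η A′) ⟩
  D (head A′ ∷ tail A′)
    ≡⟨ headLinear D-alt 1ℤ (c zero) (head A) u (tail A′) ⟩
  1ℤ * D (head A ∷ tail A′) + c zero * D (u ∷ tail A′)
    ≡⟨ cong₂ _+_ (*-identityˡ (D (head A ∷ tail A′)))
         (trans (cong (c zero *_) (van (u ∷ tail A′) zero λ _ → refl)) (*-zeroʳ (c zero))) ⟩
  D (head A ∷ tail A′) + 0ℤ
    ≡⟨ +-identityʳ _ ⟩
  D (head A ∷ tail A′)
    ≡⟨ addMultiples (restrict D-alt (head A)) u (λ B i → van (head A ∷ B) (suc i)) (tail c) (tail A) ⟩
  D (head A ∷ tail A)
    ≡⟨ congruent D-alt (∷-η A) ⟨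
  D A ∎
  where
  A′ : Matrix (suc n) _
  A′ i k = 1ℤ * A i k + c i * u k

-- Row `j` passes the `j` rows above it, one sign for each.
moveToFront : {D : Matrix (suc n) p → ℤ} → Alternating D → ∀ (j : Fin (suc n)) (U : Matrix (suc n) p) →
              D (U j ∷ removeAt U j) ≡ -1ℤ ^ toℕ j * D U
moveToFront D-alt zero U = trans (sym (congruent D-alt (∷-η U))) (sym (*-identityˡ _))
moveToFront {n = suc n} {D = D} D-alt (suc j) U = begin
  D (U (suc j) ∷ removeAt U (suc j))
    ≡⟨ congruent D-alt (∷-cong {u = U (suc j)} (λ _ → refl) (∷-η (removeAt U (suc j)))) ⟩
  D (U (suc j) ∷ head U ∷ removeAt (tail U) j)
    ≡⟨ swap D-alt (U (suc j)) (head U) (removeAt (tail U) j) ⟩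
  -1ℤ * D (head U ∷ U (suc j) ∷ removeAt (tail U) j)
    ≡⟨ cong (-1ℤ *_) (moveToFront (restrict D-alt (head U)) j (tail U)) ⟩
  -1ℤ * (-1ℤ ^ toℕ j * D (head U ∷ tail U))
    ≡⟨ *-assoc -1ℤ (-1ℤ ^ toℕ j) _ ⟨
  -1ℤ ^ toℕ (suc j) * D (head U ∷ tail U)
    ≡⟨ cong (-1ℤ ^ toℕ (suc j) *_) (congruent D-alt (∷-η U)) ⟨
  -1ℤ ^ toℕ (suc j) * D U ∎

-- Induction on the size: write the first row in the standard basis. Once `unit j` is on top, column
-- `j` of the other rows can be cleared, which leaves an alternating form on matrices one size
-- smaller.
alternating-unique : {D : Matrix n n → ℤ} → Alternating D → ∀ A → D A ≡ det (A ᵀ) * D unit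
alternating-unique {D = D} (nullary c) A = trans (c λ ()) (sym (*-identityˡ (D unit)))
alternating-unique {n = suc n} {D = D} D-alt A = begin
  D A
    ≡⟨ congruent D-alt (λ { zero k → sym (∑-unit (head A) k) ; (suc _) _ → refl }) ⟩
  D ((λ k → ∑[ j < suc n ] (head A j * unit j k)) ∷ tail A)
    ≡⟨ headLinear-∑ D-alt (head A) unit (tail A) ⟩
  ∑[ j < suc n ] (head A j * D (unit j ∷ tail A))
    ≡⟨ sum-cong-≗ (λ j → trans (cong (head A j *_) (minorTerm j))
         (regroup (head A j) (det (minor j (A ᵀ))) (-1ℤ ^ toℕ j) (D unit))) ⟩
  ∑[ j < suc n ] (-1ℤ ^ toℕ j * head A j * det (minor j (A ᵀ)) * D unit)
    ≡⟨ *-distribʳ-sum (D unit) (λ j → -1ℤ ^ toℕ j * head A j * det (minor j (A ᵀ))) ⟨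
  det (A ᵀ) * D unit ∎
  where
  regroup : ∀ x d s y → x * (d * (s * y)) ≡ s * x * d * y
  regroup = solve-∀

  module _ (j : Fin (suc n)) where
    ι : Vector ℤ n → Vector ℤ (suc n)
    ι x = insertAt x j 0ℤ

    E : Matrix n (suc n) → ℤ
    E = D ∘ (unit j ∷_)

    A∖j : Matrix n n
    A∖j i = removeAt (A (suc i)) j

    minorTerm : E (tail A) ≡ det (minor j (A ᵀ)) * (-1ℤ ^ toℕ j * D unit)
    minorTerm = begin
      E (tail A)
        ≡⟨ congruent (restrict D-alt (unit j)) (λ i → insert-remove j (A (suc i))) ⟨
      E (λ i k → 1ℤ * ι (A∖j i) k + A (suc i) j * unit j k)
        -- Column `j` is cleared by subtracting multiples of the top row `unit j`.
        ≡⟨ addMultiples (restrict D-alt (unit j)) (unit j) (λ B i → headRepeated D-alt (unit j) B i)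
             (λ i → A (suc i) j) (map ι A∖j) ⟩
      E (map ι A∖j)
        ≡⟨ alternating-unique (alternating-map (insert-linear j) (restrict D-alt (unit j))) A∖j ⟩
      det (A∖j ᵀ) * E (map ι unit)
        -- The remaining value is at the identity with row `j` moved to the top; this supplies the
        -- sign of the Laplace expansion.
        ≡⟨ cong (det (A∖j ᵀ) *_) (trans
             (congruent (restrict D-alt (unit j)) (insert-unit j))
             (moveToFront D-alt j unit)) ⟩
      det (minor j (A ᵀ)) * (-1ℤ ^ toℕ j * D unit) ∎

-- Transposition and multiplicativity of the determinant

det-cong : Congruent (det {n})
det-cong {n} = congruent (det-alternating {n})

det-unit : ∀ n → det (unit {n}) ≡ 1ℤ
det-unit zero    = refl
det-unit (suc n) = cong₂ _+_
  (trans (*-identityˡ _) (det-unit n))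
  (∑-zero λ i → cong (_* det (minor (suc i) (unit {suc n}))) (*-zeroʳ (-1ℤ ^ toℕ (suc i))))

det-ᵀ : (A : Matrix n n) → det A ≡ det (A ᵀ)
det-ᵀ {n} A = trans (alternating-unique (det-alternating {n}) A)
  (trans (cong (det (A ᵀ) *_) (det-unit n)) (*-identityʳ (det (A ᵀ))))

unit-ᵀ : unit {n} ᵀ ≋ unit
unit-ᵀ zero    zero    = refl
unit-ᵀ zero    (suc j) = refl
unit-ᵀ (suc i) zero    = refl
unit-ᵀ (suc i) (suc j) = unit-ᵀ i j

*ₘ-congʳ : {A A′ : Matrix m n} (B : Matrix n p) → A ≋ A′ → A *ₘ B ≋ A′ *ₘ B
*ₘ-congʳ B A≋A′ i k = sum-cong-≗ λ j → cong (_* B j k) (A≋A′ i j)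

*ₘ-identityˡ : (B : Matrix n p) → unit *ₘ B ≋ B
*ₘ-identityˡ B i k = trans
  (sum-cong-≗ λ j → trans (*-comm (unit i j) (B j k)) (cong (B j k *_) (unit-ᵀ j i)))
  (∑-unit (λ j → B j k) i)

*ₘ-identityʳ : (A : Matrix m n) → A *ₘ unit ≋ A
*ₘ-identityʳ A i = ∑-unit (A i)

*ₘ-assoc : (A : Matrix m n) (B : Matrix n p) (C : Matrix p q) → (A *ₘ B) *ₘ C ≋ A *ₘ (B *ₘ C)
*ₘ-assoc {n = n} {p = p} A B C i l = begin
  ∑[ k < p ] (∑[ j < n ] (A i j * B j k) * C k l)
    ≡⟨ sum-cong-≗ (λ k → trans (*-distribʳ-sum (C k l) (λ j → A i j * B j k))
         (sum-cong-≗ λ j → *-assoc (A i j) (B j k) (C k l))) ⟩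
  ∑[ k < p ] ∑[ j < n ] (A i j * (B j k * C k l))
    ≡⟨ ∑-comm (λ k j → A i j * (B j k * C k l)) ⟩
  ∑[ j < n ] ∑[ k < p ] (A i j * (B j k * C k l))
    ≡⟨ sum-cong-≗ (λ j → *-distribˡ-sum (A i j) (λ k → B j k * C k l)) ⟨
  ∑[ j < n ] (A i j * ∑[ k < p ] (B j k * C k l)) ∎

rowTimes-linear : (B : Matrix n p) → Linear (λ x k → ∑[ j < n ] (x j * B j k))
rowTimes-linear B = record
  { resp = λ u≗v k → sum-cong-≗ λ j → cong (_* B j k) (u≗v j)
  ; homo = λ a b u v k → trans
      (sum-cong-≗ λ j → distrib a b (u j) (v j) (B j k))
      (∑-combination a b (λ j → u j * B j k) (λ j → v j * B j k))
  }
  where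
  distrib : ∀ a b x y z → (a * x + b * y) * z ≡ a * (x * z) + b * (y * z)
  distrib = solve-∀

-- For fixed `B` the left side is an alternating form in the rows of `A`, each of which is
-- multiplied by `B`; its value at the identity is `det B`.
det-*ₘ : (A B : Matrix n n) → det (A *ₘ B) ≡ det A * det B
det-*ₘ {n} A B = trans
  (alternating-unique (alternating-map (rowTimes-linear B) (det-alternating {n})) A)
  (cong₂ _*_ (sym (det-ᵀ A)) (det-cong (*ₘ-identityˡ B)))

-- Unimodular matrices and sizes of invertible matrices

Unimodular : Matrix n n → Set
Unimodular A = det A ≡ 1ℤ ⊎ det A ≡ -1ℤ

i*j≡1⇒i≡±1 : ∀ i j → i * j ≡ 1ℤ → i ≡ 1ℤ ⊎ i ≡ -1ℤ
i*j≡1⇒i≡±1 i j ij≡1 =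
  ∣i∣≡1 i (ℕ.m*n≡1⇒m≡1 ∣ i ∣ ∣ j ∣ (trans (sym (abs-* i j)) (cong ∣_∣ ij≡1)))
  where
  ∣i∣≡1 : ∀ i → ∣ i ∣ ≡ 1 → i ≡ 1ℤ ⊎ i ≡ -1ℤ
  ∣i∣≡1 (ℤ.pos 1) refl = inj₁ refl
  ∣i∣≡1 (-[1+ 0 ]) refl = inj₂ refl

±1*±1 : ∀ {i j} → i ≡ 1ℤ ⊎ i ≡ -1ℤ → j ≡ 1ℤ ⊎ j ≡ -1ℤ → i * j ≡ 1ℤ ⊎ i * j ≡ -1ℤ
±1*±1 (inj₁ refl) (inj₁ refl) = inj₁ refl
±1*±1 (inj₁ refl) (inj₂ refl) = inj₂ refl
±1*±1 (inj₂ refl) (inj₁ refl) = inj₂ refl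
±1*±1 (inj₂ refl) (inj₂ refl) = inj₁ refl

±1-multiple : ∀ {i} {X : Set} {f g : X → ℤ} → i ≡ 1ℤ ⊎ i ≡ -1ℤ →
              (∀ x → f x ≡ i * g x) → (f ≗ g) ⊎ (f ≗ λ x → - g x)
±1-multiple (inj₁ refl) f≗ig = inj₁ λ x → trans (f≗ig x) (*-identityˡ _)
±1-multiple (inj₂ refl) f≗ig = inj₂ λ x → trans (f≗ig x) (-1*i≡-i _)

inverse⇒unimodular : (P Q : Matrix n n) → P *ₘ Q ≋ unit → Unimodular P
inverse⇒unimodular {n} P Q PQ≋1 = i*j≡1⇒i≡±1 (det P) (det Q)
  (trans (sym (det-*ₘ P Q)) (trans (det-cong PQ≋1) (det-unit n)))

-- Padding by zero columns and rows turns a one-sided inverse of a tall matrix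
-- into one of a square matrix with a zero column.
rightInverse⇒≤ : (A : Matrix m n) (B : Matrix n m) → A *ₘ B ≋ unit → m ℕ.≤ n
rightInverse⇒≤ {m} {n} A B AB≋1 = ℕ.≮⇒≥ λ n<m →
  let o , 1+n+o≡m = ℕ.m≤n⇒∃[o]m+o≡n n<m
  in tall o A B AB≋1 (trans (sym 1+n+o≡m) (cong suc (ℕ.+-comm n o)))
  where
  pad : ∀ {n} → Matrix m n → Matrix m (suc n)
  pad A i = 0ℤ ∷ A i

  pad-inverse : ∀ {n} (A : Matrix m n) (B : Matrix n m) → A *ₘ B ≋ unit → pad A *ₘ (𝟎 ∷ B) ≋ unit
  pad-inverse A B AB≋1 i k = trans (+-identityˡ _) (AB≋1 i k)

  -- There are `suc o` columns too few. After `o` paddings exactly one is missing, and the last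
  -- padding makes the matrix square.
  tall : ∀ o {n} (A : Matrix m n) (B : Matrix n m) → A *ₘ B ≋ unit → m ≡ suc (o ℕ.+ n) → ⊥
  tall (suc o) {n} A B AB≋1 eq =
    tall o (pad A) (𝟎 ∷ B) (pad-inverse A B AB≋1) (trans eq (cong suc (sym (ℕ.+-suc o n))))
  tall zero    A B AB≋1 refl =
    nonUnimodular (inverse⇒unimodular (pad A) (𝟎 ∷ B) (pad-inverse A B AB≋1))
    where
    det≡0 : det (pad A) ≡ 0ℤ
    det≡0 = ∑-zero λ i → cong (_* det (minor i (pad A))) (*-zeroʳ (-1ℤ ^ toℕ i))
    nonUnimodular : Unimodular (pad A) → ⊥
    nonUnimodular (inj₁ det≡1)  with () ← trans (sym det≡0) det≡1
    nonUnimodular (inj₂ det≡-1) with () ← trans (sym det≡0) det≡-1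

-- Matrices with the same image

TrivialKernel : Matrix m n → Set
TrivialKernel A = ∀ x → Kernel A x → x ≗ 𝟎

-- Each column of the difference of `X` and `Y` lies in the kernel of `A`.
*ₘ-cancelˡ : (A : Matrix m n) → TrivialKernel A → (X Y : Matrix n p) → A *ₘ X ≋ A *ₘ Y → X ≋ Y
*ₘ-cancelˡ A inj X Y AX≋AY j k = begin
  X j k                          ≡⟨ split (X j k) (Y j k) ⟩
  (X j k + - Y j k) + Y j k      ≡⟨ cong (_+ Y j k) (inj (λ j → X j k + - Y j k) difference j) ⟩
  0ℤ + Y j k                     ≡⟨ +-identityˡ (Y j k) ⟩
  Y j k                          ∎
  where
  split : ∀ x y → x ≡ (x + - y) + y
  split = solve-∀
  difference : Kernel A (λ j → X j k + - Y j k)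
  difference i = begin
    (A *ᵥ λ j → X j k + - Y j k) i             ≡⟨ *ᵥ-+ A (λ j → X j k) (λ j → - Y j k) i ⟩
    (A *ₘ X) i k + (A *ᵥ λ j → - Y j k) i      ≡⟨ cong₂ _+_
      (AX≋AY i k) (*ᵥ-neg A (λ j → Y j k) i) ⟩
    (A *ₘ Y) i k + - (A *ₘ Y) i k              ≡⟨ +-inverseʳ ((A *ₘ Y) i k) ⟩
    0ℤ                                         ∎

-- The columns of `B` are the images of the standard basis; integral preimages of them under `A`
-- form the columns of `P`.
factor : (A : Matrix m n) (B : Matrix m p) → Image B ⊆ Image A → ∃[ P ] A *ₘ P ≋ B
factor A B B⊆A = (λ j k → proj₁ (column∈A k) j) , λ i k → proj₂ (column∈A k) i
  where
  column∈A : ∀ k → Image A (λ i → B i k)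
  column∈A k = B⊆A ((λ j → unit j k) , λ i → ∑-unit (B i) k)

-- `A P Q = B Q = A`, and `A` can be cancelled.
factors-inverse : (A : Matrix m n) (B : Matrix m p) → TrivialKernel A →
                  (P : Matrix n p) (Q : Matrix p n) → A *ₘ P ≋ B → B *ₘ Q ≋ A → P *ₘ Q ≋ unit
factors-inverse A B inj P Q AP≋B BQ≋A = *ₘ-cancelˡ A inj (P *ₘ Q) unit λ i k → begin
  (A *ₘ (P *ₘ Q)) i k   ≡⟨ *ₘ-assoc A P Q i k ⟨
  ((A *ₘ P) *ₘ Q) i k   ≡⟨ *ₘ-congʳ Q AP≋B i k ⟩
  (B *ₘ Q) i k          ≡⟨ BQ≋A i k ⟩
  A i k                 ≡⟨ *ₘ-identityʳ A i k ⟨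
  (A *ₘ unit) i k       ∎

sameImage⇒sameSize : (A : Matrix m n) (B : Matrix m p) → TrivialKernel A → TrivialKernel B →
                     Image A ≐ Image B → n ≡ p
sameImage⇒sameSize A B A-inj B-inj (A⊆B , B⊆A)
  using P , AP≋B ← factor A B B⊆A
      | Q , BQ≋A ← factor B A A⊆B
  = ℕ.≤-antisym
    (rightInverse⇒≤ P Q (factors-inverse A B A-inj P Q AP≋B BQ≋A))
    (rightInverse⇒≤ Q P (factors-inverse B A B-inj Q P BQ≋A AP≋B))

sameImage⇒unimodular : (A B : Matrix m n) → TrivialKernel A → Image A ≐ Image B →
                       ∃[ P ] (A *ₘ P ≋ B × Unimodular P)
sameImage⇒unimodular A B A-inj (A⊆B , B⊆A)
  using P , AP≋B ← factor A B B⊆A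
      | Q , BQ≋A ← factor B A A⊆B
  = P , AP≋B , inverse⇒unimodular P Q (factors-inverse A B A-inj P Q AP≋B BQ≋A)

-- Bases of the cycle group

module _ (G : Graph) where
  open Graph G using (#E)
  open AbelianGroup (Z₁ G) using (rawMonoid)

  multiple-edge : ∀ c z e → proj₁ (_·_ (Z₁ G) c z) e ≡ proj₁ z e * c
  multiple-edge c z e = trans (·≡* c) (*-comm c (proj₁ z e))
    where
    open RawMonoidOps rawMonoid renaming (_×_ to _×ℕ_)
    ×ℕ≡* : ∀ n → proj₁ (n ×ℕ z) e ≡ ℤ.pos n * proj₁ z e
    ×ℕ≡* zero    = sym (*-zeroˡ (proj₁ z e))
    ×ℕ≡* (suc n) = begin
      proj₁ z e + proj₁ (n ×ℕ z) e      ≡⟨ cong₂ _+_ (sym (*-identityˡ (proj₁ z e))) (×ℕ≡* n) ⟩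
      1ℤ * proj₁ z e + ℤ.pos n * proj₁ z e  ≡⟨ *-distribʳ-+ (proj₁ z e) 1ℤ (ℤ.pos n) ⟨
      ℤ.pos (suc n) * proj₁ z e               ∎
    ·≡* : ∀ c → proj₁ (_·_ (Z₁ G) c z) e ≡ c * proj₁ z e
    ·≡* (ℤ.pos n)    = ×ℕ≡* n
    ·≡* -[1+ n ] = trans (cong -_ (×ℕ≡* (suc n))) (neg-distribˡ-* (ℤ.pos (suc n)) (proj₁ z e))

  edgeMatrix : Vector (Cycle G) n → Matrix #E n
  edgeMatrix zs e i = proj₁ (zs i) e

  -- Translates the abstract ℤ-module structure of `Z₁ G` into matrices: independence becomes a
  -- trivial kernel, and spanning a statement about images.
  combination-edge : (c : Vector ℤ n) (zs : Vector (Cycle G) n) →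
                     proj₁ (combination (Z₁ G) c zs) ≗ edgeMatrix zs *ᵥ c
  combination-edge {zero}  c zs e = refl
  combination-edge {suc n} c zs e =
    cong₂ _+_ (multiple-edge (c zero) (zs zero) e) (combination-edge (tail c) (tail zs) e)

  module _ (β : Basis (Z₁ G) n) where
    open Basis β

    basisMatrix : Matrix #E n
    basisMatrix = edgeMatrix vectors

    basisMatrix-trivialKernel : TrivialKernel basisMatrix
    basisMatrix-trivialKernel c Vc≗0 =
      independent c λ e → trans (combination-edge c vectors e) (Vc≗0 e)

    basisMatrix-coordinates : ∀ z → basisMatrix *ᵥ coordinates z ≗ proj₁ z
    basisMatrix-coordinates z e =
      trans (sym (combination-edge (coordinates z) vectors e)) (proj₂ (spanning z) e)

  -- Every vector in the image of `basisMatrix β` is a cycle, so it has coordinates in `β′`.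
  basisImage-⊆ : (β : Basis (Z₁ G) m) (β′ : Basis (Z₁ G) n) →
                 Image (basisMatrix β) ⊆ Image (basisMatrix β′)
  basisImage-⊆ β β′ (c , Vc≗y) = Basis.coordinates β′ z , λ e → trans
    (basisMatrix-coordinates β′ z e)
    (trans (combination-edge c (Basis.vectors β) e) (Vc≗y e))
    where z = combination (Z₁ G) c (Basis.vectors β)

-- Winding numbers

-- The block sum `1 ⊕ M`: on the right it keeps the cycle column and changes the columns of the
-- unicyclizer by `M`.
border : Matrix n n → Matrix (suc n) (suc n)
border M = unit zero ∷ λ i → 0ℤ ∷ M i

det-border : (M : Matrix n n) → det (border M) ≡ det M
det-border M = trans
  (cong₂ _+_ (*-identityˡ (det M))
    (∑-zero λ i → cong (_* det (minor (suc i) (border M))) (*-zeroʳ (-1ℤ ^ toℕ (suc i)))))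
  (+-identityʳ (det M))

prepend-border : (z : Vector ℤ m) (A : Matrix m n) (M : Matrix n n) →
                 (λ e → z e ∷ A e) *ₘ border M ≋ λ e → z e ∷ (A *ₘ M) e
prepend-border z A M e zero    = trans
  (cong₂ _+_ (*-identityʳ (z e)) (∑-zero λ j → *-zeroʳ (A e j))) (+-identityʳ (z e))
prepend-border z A M e (suc k) = trans
  (cong (_+ (A *ₘ M) e k) (*-zeroʳ (z e))) (+-identityˡ ((A *ₘ M) e k))

-- Passing from coordinates to edge vectors gives a matrix independent of `β`, in which different
-- bases can be compared.
basisMatrix-winding : {G : Graph} {k : ℕ} (𝒜 : Unicyclizer G k) (β : Basis (Z₁ G) (suc k)) → ∀ z →
                      basisMatrix G β *ₘ windingMatrix 𝒜 β z ≋ λ e → proj₁ z e ∷ ∂ 𝒜 e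
basisMatrix-winding {G} 𝒜 β z e zero    = basisMatrix-coordinates G β z e
basisMatrix-winding {G} 𝒜 β z e (suc j) =
  basisMatrix-coordinates G β (Unicyclizer.column 𝒜 j) e

module _ {G : Graph} {k : ℕ} (𝒜 𝒜′ : Unicyclizer G k) (β β′ : Basis (Z₁ G) (suc k)) where
  private
    V  = basisMatrix G β
    V′ = basisMatrix G β′

  -- The factor `det P * det M` does not depend on `z`, so one sign serves all cycles.
  winding-transition : (P : Matrix (suc k) (suc k)) (M : Matrix k k) →
                       V *ₘ P ≋ V′ → ∂ 𝒜′ *ₘ M ≋ ∂ 𝒜 →
                       ∀ z → winding 𝒜 β z ≡ det P * det M * winding 𝒜′ β′ z
  winding-transition P M VP≋V′ ∂′M≋∂ z = begin
    det W                         ≡⟨ det-cong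
      (*ₘ-cancelˡ V (basisMatrix-trivialKernel G β) W (P *ₘ (W′ *ₘ N)) VW≋VPW′N) ⟩
    det (P *ₘ (W′ *ₘ N))          ≡⟨ det-*ₘ P (W′ *ₘ N) ⟩
    det P * det (W′ *ₘ N)         ≡⟨ cong (det P *_) (trans (det-*ₘ W′ N)
      (cong (det W′ *_) (det-border M))) ⟩
    det P * (det W′ * det M)      ≡⟨ cong (det P *_) (*-comm (det W′) (det M)) ⟩
    det P * (det M * det W′)      ≡⟨ *-assoc (det P) (det M) (det W′) ⟨
    det P * det M * det W′        ∎
    where
    N  = border M
    W  = windingMatrix 𝒜 β z
    W′ = windingMatrix 𝒜′ β′ z

    VW≋VPW′N : V *ₘ W ≋ V *ₘ (P *ₘ (W′ *ₘ N))
    VW≋VPW′N e i = begin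
      (V *ₘ W) e i                           ≡⟨ basisMatrix-winding 𝒜 β z e i ⟩
      (proj₁ z e ∷ ∂ 𝒜 e) i                  ≡⟨ ∷-cong₁ i ⟨
      (proj₁ z e ∷ (∂ 𝒜′ *ₘ M) e) i          ≡⟨ prepend-border (proj₁ z) (∂ 𝒜′) M e i ⟨
      ((λ e → proj₁ z e ∷ ∂ 𝒜′ e) *ₘ N) e i  ≡⟨ *ₘ-congʳ N (basisMatrix-winding 𝒜′ β′ z) e i ⟨
      ((V′ *ₘ W′) *ₘ N) e i                  ≡⟨ *ₘ-assoc V′ W′ N e i ⟩
      (V′ *ₘ (W′ *ₘ N)) e i                  ≡⟨ *ₘ-congʳ (W′ *ₘ N) VP≋V′ e i ⟨
      ((V *ₘ P) *ₘ (W′ *ₘ N)) e i            ≡⟨ *ₘ-assoc V P (W′ *ₘ N) e i ⟩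
      (V *ₘ (P *ₘ (W′ *ₘ N))) e i            ∎
      where
      ∷-cong₁ : (proj₁ z e ∷ (∂ 𝒜′ *ₘ M) e) ≗ (proj₁ z e ∷ ∂ 𝒜 e)
      ∷-cong₁ zero    = refl
      ∷-cong₁ (suc j) = ∂′M≋∂ e j

  winding-±-equal : Image (∂ 𝒜) ≐ Image (∂ 𝒜′) →
    (winding 𝒜 β ≗ winding 𝒜′ β′) ⊎ (winding 𝒜 β ≗ λ z → - winding 𝒜′ β′ z)
  winding-±-equal (∂⊆∂′ , ∂′⊆∂)
    using P , VP≋V′ , P-unimodular ←
            sameImage⇒unimodular V V′ (basisMatrix-trivialKernel G β)
            ((λ {y} → basisImage-⊆ G β β′ {y}) , λ {y} → basisImage-⊆ G β′ β {y})
        | M , ∂′M≋∂ , M-unimodular ←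
            -- The unicyclizers enter in the opposite order to the bases, because `∂ 𝒜` is to be
            -- expressed through `∂ 𝒜′`.
            sameImage⇒unimodular (∂ 𝒜′) (∂ 𝒜) (Unicyclizer.trivialKernel 𝒜′)
            ((λ {y} → ∂′⊆∂ {y}) , λ {y} → ∂⊆∂′ {y})
    = ±1-multiple (±1*±1 P-unimodular M-unimodular) (winding-transition P M VP≋V′ ∂′M≋∂)

-- Equality of the homology groups and conclusion

-- Both groups have the cycles as carrier and the same operations. Only their equalities depend on
-- the matrix, and they do so through its image; the identity being an isomorphism thus expresses
-- that the quotients are equal.
H₁-id-isomorphism : (G : Graph) {k k′ : ℕ} (A : Matrix (Graph.#E G) k) (B : Matrix (Graph.#E G) k′) →
                    Image A ≐ Image B → IsGroupIsomorphism (rawGroup (H₁ G A)) (rawGroup (H₁ G B)) id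
H₁-id-isomorphism G A B (A⊆B , B⊆A) = record
  { isGroupMonomorphism = record
    { isGroupHomomorphism = record
      { isMonoidHomomorphism = record
        { isMagmaHomomorphism = record
          { isRelHomomorphism = record { cong = λ x∼y → A⊆B x∼y }
          ; homo = λ x y → AbelianGroup.refl (H₁ G B) {AbelianGroup._∙_ (H₁ G B) x y}
          }
        ; ε-homo = AbelianGroup.refl (H₁ G B) {AbelianGroup.ε (H₁ G B)}
        }
      ; ⁻¹-homo = λ x → AbelianGroup.refl (H₁ G B) {AbelianGroup._⁻¹ (H₁ G B) x}
      }
    ; injective = λ x∼y → B⊆A x∼y
    }
  ; surjective = λ y → y , λ z∼y → A⊆B z∼y
  }

proposition4p4p1 : (G : Graph) → Connected G →
    {k k′ : ℕ} (𝒜 : Unicyclizer G k) (𝒜′ : Unicyclizer G k′) →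
    Image (∂ 𝒜) ≐ Image (∂ 𝒜′) →
    (β : Basis (Z₁ G) (suc k)) (β′ : Basis (Z₁ G) (suc k′)) →
    ((winding 𝒜 β ≗ winding 𝒜′ β′) ⊎ (winding 𝒜 β ≗ λ z → - winding 𝒜′ β′ z))
    × IsGroupIsomorphism (rawGroup (H₁ G (∂ 𝒜))) (rawGroup (H₁ G (∂ 𝒜′))) id
proposition4p4p1 G _ 𝒜 𝒜′ im≐im′ β β′
  -- Identifying the two numbers of columns gives both winding matrices the same size.
  with refl ← sameImage⇒sameSize (∂ 𝒜) (∂ 𝒜′)
                (Unicyclizer.trivialKernel 𝒜) (Unicyclizer.trivialKernel 𝒜′) im≐im′
  = winding-±-equal 𝒜 𝒜′ β β′ im≐im′ , H₁-id-isomorphism G (∂ 𝒜) (∂ 𝒜′) im≐im′
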